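{- For every 3-uniform hypergraph $H$ with $R_2(H)\geq 7$, we have $f(H,\mathcal{M})=R_2(H)$.
   Context: For a 3-graph $H$, $R_2(H)$ is the minimum $n$ such that every 2-edge-coloring of $K^{(3)}_n$ contains a monochromatic copy of $H$. The constrained Ramsey number $f(H,G)$ is the minimum $n$ such that every edge-coloring of $K^{(3)}_n$ with any number of colors contains either a monochromatic copy of $H$ or a rainbow copy of $G$ (all edges of distinct colors). The messy path $\mathcal{M}$ is the 3-graph with vertices $v_1,\ldots,v_6$ and edges $\{v_1v_2v_3,v_2v_3v_4,v_4v_5v_6\}$. -}

module Defs where

open import Data.Nat using (ℕ; _<_)
open import Data.Fin using (Fin; zero; suc)
open import Data.Fin.Patterns
open import Data.Product using (Σ; _×_; _,_)
open import Data.Sum using (_⊎_)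
open import Data.List using (List; []; _∷_; length; lookup)
open import Data.List.Relation.Unary.All using (All; []; _∷_)
open import Relation.Binary.PropositionalEquality using (_≡_; _≢_)
open import Relation.Nullary using (¬_)
open import Function.Definitions using (Injective)

-- An (unordered) 3-set is listed as an ordered triple of pairwise distinct vertices.
Triple : ℕ → Set
Triple k = Fin k × Fin k × Fin k

Distinct3 : ∀ {k} → Triple k → Set
Distinct3 (a , b , c) = a ≢ b × b ≢ c × a ≢ c

record ThreeGraph : Set where
  field
    nV    : ℕ
    edges : List (Triple nV)
    edges-3sets : All Distinct3 edges
open ThreeGraph public

-- An edge-colouring of K^(3)_n with colours in C: a function on triples which is
-- invariant under permuting its arguments (values on non-3-sets are irrelevant).
Colouring : ℕ → Set → Set
Colouring n C = Fin n → Fin n → Fin n → C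

Symmetric : ∀ {n C} → Colouring n C → Set
Symmetric {n} c = (a b d : Fin n) → (c a b d ≡ c b a d) × (c a b d ≡ c a d b)

colourOf : ∀ {n C} → Colouring n C → Triple n → C
colourOf c (a , b , d) = c a b d

mapT : ∀ {k n} → (Fin k → Fin n) → Triple k → Triple n
mapT φ (a , b , d) = φ a , φ b , φ d

MonoCopy : ∀ {n C} → ThreeGraph → Colouring n C → Set
MonoCopy {n} {C} H c =
  Σ (Fin (nV H) → Fin n) λ φ → Injective _≡_ _≡_ φ ×
    Σ C λ col → All (λ e → colourOf c (mapT φ e) ≡ col) (edges H)

RainbowCopy : ∀ {n C} → ThreeGraph → Colouring n C → Set
RainbowCopy {n} G c =
  Σ (Fin (nV G) → Fin n) λ φ → Injective _≡_ _≡_ φ ×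
    ((i j : Fin (length (edges G))) → i ≢ j →
       colourOf c (mapT φ (lookup (edges G) i)) ≢ colourOf c (mapT φ (lookup (edges G) j)))

Ramsey2Prop : ThreeGraph → ℕ → Set
Ramsey2Prop H n = (c : Colouring n (Fin 2)) → Symmetric c → MonoCopy H c

-- every colouring of K^(3)_n (any number of colours; colours drawn from ℕ, which
-- suffices since K^(3)_n has finitely many edges) has a mono H or a rainbow G.
ConstrainedProp : ThreeGraph → ThreeGraph → ℕ → Set
ConstrainedProp H G n =
  (c : Colouring n ℕ) → Symmetric c → MonoCopy H c ⊎ RainbowCopy G c

IsMin : (ℕ → Set) → ℕ → Set
IsMin P r = P r × ((m : ℕ) → m < r → ¬ P m)

IsR2 : ThreeGraph → ℕ → Set
IsR2 H r = IsMin (Ramsey2Prop H) r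

IsF : ThreeGraph → ThreeGraph → ℕ → Set
IsF H G r = IsMin (ConstrainedProp H G) r

messyEdges : List (Triple 6)
messyEdges = (0F , 1F , 2F) ∷ (1F , 2F , 3F) ∷ (3F , 4F , 5F) ∷ []

messy : ThreeGraph
messy = record
  { nV = 6
  ; edges = messyEdges
  ; edges-3sets =
      ((λ ()) , (λ ()) , (λ ())) ∷ ((λ ()) , (λ ()) , (λ ()))
        ∷ ((λ ()) , (λ ()) , (λ ())) ∷ []
  }

{-# OPTIONS --safe #-}
-- Let c be a colouring of the triples of at least seven vertices without a
-- rainbow messy path.  If two disjoint triples A and B have different colours α
-- and β, then every triple inside A ∪ B with two vertices in A is coloured α or β,
-- being the middle edge of a messy path with end edges A and B.  A triple g of a
-- third colour γ yields further differently coloured disjoint pairs inside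
-- A ∪ B ∪ g, and, however g meets A and B, one of the triples would need a colour
-- in {α, γ} ∩ {β, γ} ∩ {α, β} = ∅.  If instead disjoint triples always share
-- their colour, then so do all triples, since the Kneser graph of 3-sets is
-- connected on seven or more points.  Hence c uses at most two colours, and the
-- two-colour Ramsey property applies.  Conversely a colouring with two colours
-- has no rainbow messy path at all.
module Submission where

open import Defs
open import Data.Bool using (if_then_else_)
open import Data.Nat using (ℕ; zero; suc; _≤_; _<_; s≤s)
import Data.Nat as ℕ
import Data.Nat.Properties as ℕ
open import Data.Fin using (Fin; zero; suc; toℕ; _≟_)
open import Data.Fin.Patterns
open import Data.Fin.Properties using (any?; pigeonhole; toℕ-injective; <⇒≢)
open import Data.Product using (∃; ∃₂; _×_; _,_; proj₁; proj₂)
open import Data.Sum using (_⊎_; inj₁; inj₂; [_,_]; swap)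
open import Data.List using (List; []; _∷_; _++_; length; map; lookup)
open import Data.List.Relation.Unary.All as All using (All; []; _∷_)
import Data.List.Relation.Unary.All.Properties as All
open import Data.List.Relation.Unary.Any as Any using (Any; here; there; index)
open import Data.List.Relation.Unary.AllPairs using ([]; _∷_; head)
open import Data.List.Relation.Unary.Unique.Propositional using (Unique)
open import Data.List.Relation.Unary.Unique.DecPropositional using (unique?)
import Data.List.Relation.Unary.Unique.Propositional.Properties as Unique
import Data.List.Membership.DecPropositional as DecMembership
open import Data.List.Membership.Propositional using (_∈_; _∉_; lose)
open import Data.List.Membership.Propositional.Properties using (∈-lookup; ∈-++⁻)
import Data.List.Membership.Setoid.Properties as Membership
open import Data.List.Relation.Binary.Permutation.Propositional
  using (_↭_; prep; trans; ↭-refl; ↭-sym; ↭⇒↭ₛ)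
import Data.List.Relation.Binary.Permutation.Propositional as ↭
open import Data.List.Relation.Binary.Permutation.Propositional.Properties
  using (++⁺; ++-comm; ∈-resp-↭)
import Data.List.Relation.Binary.Permutation.Setoid.Properties as ↭ₛ
open import Data.Vec using (Vec; []; _∷_)
open import Function using (_∘_)
open import Function.Definitions using (Injective)
open import Relation.Binary.PropositionalEquality as ≡
  using (_≡_; _≢_; refl; sym; cong; ≢-sym; setoid)
open import Relation.Nullary using (Dec; yes; no; contradiction; ¬?; _×-dec_)
open import Relation.Nullary.Decidable using (True; toWitness; decidable-stable; map′; ⌊_⌋)
open import Relation.Unary using (Decidable)

-- Duplicate-free lists and finite search

Unique-resp-↭ : ∀ {n} {xs ys : List (Fin n)} → xs ↭ ys → Unique xs → Unique ys
Unique-resp-↭ p = ↭ₛ.Unique-resp-↭ (setoid _) (↭⇒↭ₛ p)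

lookup-injective : ∀ {A : Set} {xs : List A} → Unique xs → Injective _≡_ _≡_ (lookup xs)
lookup-injective (_ ∷ _)    {zero}  {zero}  _  = refl
lookup-injective (x∉ ∷ _)   {zero}  {suc j} eq = contradiction eq (All.lookup x∉ (∈-lookup j))
lookup-injective (x∉ ∷ _)   {suc i} {zero}  eq = contradiction (sym eq) (All.lookup x∉ (∈-lookup i))
lookup-injective (_ ∷ uniq) {suc i} {suc j} eq = cong suc (lookup-injective uniq eq)

-- The indices are literals at each use, so `True` computes to the unit type and the implicit
-- argument fills itself in. Disjointness claims below thus reduce to listing positions in one
-- duplicate-free list.
pick : ∀ {A : Set} {xs : List A} → Unique xs → (is : List (Fin (length xs)))
     → {True (unique? _≟_ is)} → Unique (map (lookup xs) is)
pick uniq is {d} = Unique.map⁺ (lookup-injective uniq) (toWitness d)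

∉⇒Unique : ∀ {n} {x : Fin n} {xs} → x ∉ xs → Unique xs → Unique (x ∷ xs)
∉⇒Unique x∉xs uniq = All.¬Any⇒All¬ _ x∉xs ∷ uniq

-- If every vertex occurred in `xs`, then `index` would inject `Fin n` into fewer than `n`
-- positions.
fresh : ∀ {n} (xs : List (Fin n)) → length xs < n → ∃ (_∉ xs)
fresh {n} xs len<n with any? (λ v → ¬? (v ∈? xs))
  where open DecMembership (_≟_ {n}) using (_∈?_)
... | yes found = found
... | no none with pigeonhole len<n (index ∘ all∈)
  where
  open DecMembership (_≟_ {n}) using (_∈?_)
  all∈ : ∀ v → v ∈ xs
  all∈ v = decidable-stable (v ∈? xs) (λ v∉xs → none (v , v∉xs))
... | i , j , i<j , eq =
  contradiction (Membership.index-injective (setoid _) _ _ eq) (<⇒≢ i<j)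

-- Makes the later case splits on the existence of a suitable 6-tuple of vertices constructive.
anyVec? : ∀ {n} k {P : Vec (Fin n) k → Set} → Decidable P → Dec (∃ P)
anyVec? zero    P? = map′ ([] ,_) (λ { ([] , p) → p }) (P? [])
anyVec? (suc k) P? = map′ (λ { (x , xs , p) → x ∷ xs , p }) (λ { (x ∷ xs , p) → x , xs , p })
                          (any? (λ x → anyVec? k (P? ∘ (x ∷_))))

-- Colours drawn from a pair

Either : ∀ {C : Set} → C → C → C → Set
Either u p q = u ≡ p ⊎ u ≡ q

-- Decidable equality on `ℕ` permits arguing by contradiction: suppose that `u` is a third colour.
Either-stable : ∀ {u p q : ℕ} → (u ≢ p → u ≢ q → Either u p q) → Either u p q
Either-stable {u} {p} {q} f with u ℕ.≟ p | u ℕ.≟ q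
... | yes u≡p | _       = inj₁ u≡p
... | no _    | yes u≡q = inj₂ u≡q
... | no u≢p  | no u≢q  = f u≢p u≢q

module _ {C : Set} {u p q : C} where
  Either-cong : ∀ {v} → u ≡ v → Either v p q → Either u p q
  Either-cong refl e = e

  Either-left : Either u p q → u ≢ q → u ≡ p
  Either-left (inj₁ u≡p) _   = u≡p
  Either-left (inj₂ u≡q) u≢q = contradiction u≡q u≢q

  Either-avoid : ∀ {v} → Either u p q → v ≢ p → v ≢ q → u ≢ v
  Either-avoid (inj₁ refl) v≢p _ u≡v = v≢p (sym u≡v)
  Either-avoid (inj₂ refl) _ v≢q u≡v = v≢q (sym u≡v)

  -- Each of the three distinct colours `p`, `q`, `r` is missing from one of the three pairs.
  no-common : ∀ {r} → Either u p r → Either u q r → Either u p q →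
              p ≢ q → r ≢ p → r ≢ q → ∀ {A : Set} → A
  no-common (inj₁ refl) (inj₁ p≡q) _ p≢q _ _ = contradiction p≡q p≢q
  no-common (inj₁ refl) (inj₂ p≡r) _ _ r≢p _ = contradiction (sym p≡r) r≢p
  no-common (inj₂ refl) _ (inj₁ r≡p) _ r≢p _ = contradiction r≡p r≢p
  no-common (inj₂ refl) _ (inj₂ r≡q) _ _ r≢q = contradiction r≡q r≢q

-- Messy paths and triples up to reordering

verts : ∀ {n} → Triple n → List (Fin n)
verts (a , b , d) = a ∷ b ∷ d ∷ []

-- Rainbow-freeness in positive form. The premise compares the end edges, the only disjoint pair of
-- edges of the path.
NoRainbowMessy : ∀ {n} → Colouring n ℕ → Set
NoRainbowMessy c = ∀ {a b d e f g} → Unique (a ∷ b ∷ d ∷ e ∷ f ∷ g ∷ []) →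
                   c a b d ≢ c e f g → Either (c b d e) (c a b d) (c e f g)

module SymmetricColouring {n} (c : Colouring n ℕ) (sym-c : Symmetric c) where

  open DecMembership (_≟_ {n}) using (_∈?_)

  swap₁₂ : ∀ {x y z} → c x y z ≡ c y x z
  swap₁₂ {x} {y} {z} = proj₁ (sym-c x y z)

  swap₂₃ : ∀ {x y z} → c x y z ≡ c x z y
  swap₂₃ {x} {y} {z} = proj₂ (sym-c x y z)

  rot : ∀ {x y z} → c x y z ≡ c y z x
  rot = ≡.trans swap₁₂ swap₂₃

  rot⁻¹ : ∀ {x y z} → c x y z ≡ c z x y
  rot⁻¹ = ≡.trans swap₂₃ swap₁₂

  -- Two listings of one 3-set. The colour equation is stored beside the permutation so that it need
  -- not be derived from it.
  _~_ : Triple n → Triple n → Set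
  A ~ A′ = verts A ↭ verts A′ × colourOf c A ≡ colourOf c A′

  ~-rot : ∀ {x y z} → (x , y , z) ~ (y , z , x)
  ~-rot {x} {y} {z} = ++-comm (x ∷ []) (y ∷ z ∷ []) , rot

  ~-swap₂₃ : ∀ {x y z} → (x , y , z) ~ (x , z , y)
  ~-swap₂₃ = prep _ (↭.swap _ _ ↭-refl) , swap₂₃

  ~-trans : ∀ {A B D} → A ~ B → B ~ D → A ~ D
  ~-trans (p , e) (q , f) = trans p q , ≡.trans e f

  ~-refl : ∀ {A} → A ~ A
  ~-refl = ↭-refl , refl

  focus : ∀ {x A} → x ∈ verts A → ∃₂ λ y z → A ~ (x , y , z)
  focus (here refl)                 = _ , _ , ~-refl
  focus (there (here refl))         = _ , _ , ~-rot
  focus (there (there (here refl))) = _ , _ , ~-trans ~-rot ~-rot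

  focus₂ : ∀ {x y A} → x ∈ verts A → y ∈ verts A → x ≢ y → ∃ λ z → A ~ (x , y , z)
  focus₂ x∈A y∈A x≢y with focus x∈A
  ... | _ , _ , A~ with ∈-resp-↭ (proj₁ A~) y∈A
  ... | here y≡x                 = contradiction (sym y≡x) x≢y
  ... | there (here refl)         = _ , A~
  ... | there (there (here refl)) = _ , ~-trans A~ ~-swap₂₃

  -- `α` and `β` are parameters tied to the triples by equations, so relisting a triple leaves them
  -- fixed.
  record Opposed (α β : ℕ) (A B : Triple n) : Set where
    constructor opposed
    field
      disjoint : Unique (verts A ++ verts B)
      colourˡ  : colourOf c A ≡ α
      colourʳ  : colourOf c B ≡ β
      distinct : α ≢ β
  open Opposed

  Opposed-swap : ∀ {α β A B} → Opposed α β A B → Opposed β α B A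
  Opposed-swap {A = A} {B} (opposed u a b α≢β) =
    opposed (Unique-resp-↭ (++-comm (verts A) (verts B)) u) b a (≢-sym α≢β)

  Opposed-resp-~ : ∀ {α β A B A′ B′} → A ~ A′ → B ~ B′ → Opposed α β A B → Opposed α β A′ B′
  Opposed-resp-~ (p , e) (q , f) (opposed u a b α≢β) =
    opposed (Unique-resp-↭ (++⁺ p q) u) (≡.trans (sym e) a) (≡.trans (sym f) b) α≢β

  -- Consequences of two disjoint triples of different colours

  module TwoColours (messy-free : NoRainbowMessy c) where

    -- Apply the hypothesis to the path on `a₃`, `a₁`, `a₂`, `b₁`, `b₂`, `b₃`.
    mixed : ∀ {α β a₁ a₂ a₃ b₁ b₂ b₃} → Opposed α β (a₁ , a₂ , a₃) (b₁ , b₂ , b₃) →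
            Either (c a₁ a₂ b₁) α β
    mixed (opposed u refl refl α≢β)
      with messy-free (pick u (2F ∷ 0F ∷ 1F ∷ 3F ∷ 4F ∷ 5F ∷ [])) (α≢β ∘ ≡.trans rot⁻¹)
    ... | inj₁ e = inj₁ (≡.trans e rot)
    ... | inj₂ e = inj₂ e

    -- The triple {a₁, a₂, a₃} is the middle edge of the messy path with end edges
    -- {a₂, a₃, b₁} and {a₁, p, q}.
    inherit : ∀ {α β γ a₁ a₂ a₃ b₁ b₂ b₃ p q} → Opposed α β (a₁ , a₂ , a₃) (b₁ , b₂ , b₃) →
              Unique (a₂ ∷ a₃ ∷ b₁ ∷ a₁ ∷ p ∷ q ∷ []) → c a₁ p q ≡ γ → γ ≢ α → γ ≢ β →
              c a₂ a₃ b₁ ≡ α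
    inherit opp u g≡γ γ≢α γ≢β =
      sym (Either-left (Either-cong (≡.trans (sym (colourˡ opp)) rot)
                          (mixed (opposed u refl g≡γ (Either-avoid T∈αβ γ≢α γ≢β))))
                       (≢-sym γ≢α))
      where T∈αβ = mixed (Opposed-resp-~ ~-rot ~-refl opp)

    -- In aao, abo, aoo and ooo the letters tell where the vertices of the coloured
    -- triple lie: in A, in B, or outside A ∪ B.
    module _ {α β a₁ a₂ a₃ b₁ b₂ b₃} (opp : Opposed α β (a₁ , a₂ , a₃) (b₁ , b₂ , b₃)) where

      aao : ∀ {w} → Unique (w ∷ a₁ ∷ a₂ ∷ a₃ ∷ b₁ ∷ b₂ ∷ b₃ ∷ []) → Either (c a₁ a₂ w) α β
      aao u = Either-stable λ γ≢α γ≢β →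
        -- Let g be `{a₁, a₂, w}` and T be `{b₁, b₂, a₃}`. The middle edge between g and T is A,
        -- whose colour `α` is not `γ`, so T has colour `α`.
        let T∈βα = mixed (Opposed-resp-~ ~-refl (~-trans ~-rot ~-rot) (Opposed-swap opp))
            T≡α = sym (Either-left
                    (Either-cong (sym (colourˡ opp))
                      (swap (mixed (opposed (pick u (1F ∷ 2F ∷ 0F ∷ 3F ∷ 4F ∷ 5F ∷ [])) refl rot
                               (≢-sym (Either-avoid T∈βα γ≢β γ≢α))))))
                    (≢-sym γ≢α))
        -- The contested triple `{a₁, b₁, b₂}` is a middle edge between T and g, between B and g,
        -- and between B and A.
        in no-common
             (mixed (opposed (pick u (4F ∷ 5F ∷ 3F ∷ 1F ∷ 2F ∷ 0F ∷ [])) T≡α refl (≢-sym γ≢α)))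
             (mixed (opposed (pick u (4F ∷ 5F ∷ 6F ∷ 1F ∷ 2F ∷ 0F ∷ [])) (colourʳ opp) refl (≢-sym γ≢β)))
             (swap (mixed (Opposed-swap opp)))
             (distinct opp) γ≢α γ≢β

      abo : ∀ {w} → Unique (w ∷ a₁ ∷ a₂ ∷ a₃ ∷ b₁ ∷ b₂ ∷ b₃ ∷ []) → Either (c a₁ b₁ w) α β
      abo u = Either-stable λ γ≢α γ≢β →
        -- Here g is `{a₁, b₁, w}`. It has one vertex in each of A and B, so `inherit` works from
        -- both sides: T is `{a₂, a₃, b₂}` and S is `{b₂, b₃, a₂}`. The contested triple is
        -- `{a₁, a₂, b₂}`.
        let T≡α = inherit (Opposed-resp-~ ~-refl ~-rot opp)
                          (pick u (2F ∷ 3F ∷ 5F ∷ 1F ∷ 4F ∷ 0F ∷ [])) refl γ≢α γ≢β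
            S≡β = inherit (Opposed-resp-~ ~-refl ~-rot (Opposed-swap opp))
                          (pick u (5F ∷ 6F ∷ 2F ∷ 4F ∷ 1F ∷ 0F ∷ [])) swap₁₂ γ≢β γ≢α
        in no-common
             (mixed (opposed (pick u (2F ∷ 5F ∷ 3F ∷ 1F ∷ 4F ∷ 0F ∷ [])) (≡.trans swap₂₃ T≡α) refl (≢-sym γ≢α)))
             (mixed (opposed (pick u (2F ∷ 5F ∷ 6F ∷ 1F ∷ 4F ∷ 0F ∷ [])) (≡.trans rot S≡β) refl (≢-sym γ≢β)))
             (Either-cong rot⁻¹ (mixed (Opposed-resp-~ ~-refl ~-rot opp)))
             (distinct opp) γ≢α γ≢β

      aoo : ∀ {w w′} → Unique (w ∷ w′ ∷ a₁ ∷ a₂ ∷ a₃ ∷ b₁ ∷ b₂ ∷ b₃ ∷ []) → Either (c a₁ w w′) α β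
      aoo u = Either-stable λ γ≢α γ≢β →
        let T≡α = inherit opp (pick u (3F ∷ 4F ∷ 5F ∷ 2F ∷ 0F ∷ 1F ∷ [])) refl γ≢α γ≢β
            -- Since g misses B, `inherit` cannot be used with the sides exchanged. Instead take v,
            -- the colour of `{a₁, b₁, b₂}`: this is a middle edge between B and g, which forces
            -- `β`, and between S, now `{a₂, b₁, b₂}`, and g, which passes `β` on to S.
            v∈αβ = swap (mixed (Opposed-swap opp))
            v≡β = Either-left
                    (mixed (opposed (pick u (5F ∷ 6F ∷ 7F ∷ 2F ∷ 0F ∷ 1F ∷ [])) (colourʳ opp) refl (≢-sym γ≢β)))
                    (Either-avoid v∈αβ γ≢α γ≢β)
            S∈βα = mixed (Opposed-resp-~ ~-refl ~-rot (Opposed-swap opp))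
            S≡β = ≡.trans (sym (Either-left
                    (mixed (opposed (pick u (5F ∷ 6F ∷ 3F ∷ 2F ∷ 0F ∷ 1F ∷ [])) refl refl
                             (Either-avoid S∈βα γ≢β γ≢α)))
                    (Either-avoid v∈αβ γ≢α γ≢β))) v≡β
        -- The contested triple is `{a₁, a₂, b₁}`.
        in no-common
             (mixed (opposed (pick u (3F ∷ 5F ∷ 4F ∷ 2F ∷ 0F ∷ 1F ∷ [])) (≡.trans swap₂₃ T≡α) refl (≢-sym γ≢α)))
             (mixed (opposed (pick u (3F ∷ 5F ∷ 6F ∷ 2F ∷ 0F ∷ 1F ∷ [])) (≡.trans rot S≡β) refl (≢-sym γ≢β)))
             (Either-cong rot⁻¹ (mixed opp))
             (distinct opp) γ≢α γ≢β

    -- A third colour on `{x, y, z}` would make it opposed to both A and B. Then `abo` bounds the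
    -- colour of `{x, a₁, b₁}` from three opposed pairs.
    ooo : ∀ {α β a₁ a₂ a₃ b₁ b₂ b₃ x y z} → Opposed α β (a₁ , a₂ , a₃) (b₁ , b₂ , b₃) →
          Unique (x ∷ y ∷ z ∷ a₁ ∷ a₂ ∷ a₃ ∷ b₁ ∷ b₂ ∷ b₃ ∷ []) → Either (c x y z) α β
    ooo opp u = Either-stable λ γ≢α γ≢β → no-common
      (swap (abo (opposed (pick u (0F ∷ 1F ∷ 2F ∷ 3F ∷ 4F ∷ 5F ∷ [])) refl (colourˡ opp) γ≢α)
                 (pick u (6F ∷ 0F ∷ 1F ∷ 2F ∷ 3F ∷ 4F ∷ 5F ∷ []))))
      (Either-cong swap₂₃
        (swap (abo (opposed (pick u (0F ∷ 1F ∷ 2F ∷ 6F ∷ 7F ∷ 8F ∷ [])) refl (colourʳ opp) γ≢β)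
                   (pick u (3F ∷ 0F ∷ 1F ∷ 2F ∷ 6F ∷ 7F ∷ 8F ∷ [])))))
      (Either-cong rot (abo opp (pick u (0F ∷ 3F ∷ 4F ∷ 5F ∷ 6F ∷ 7F ∷ 8F ∷ []))))
      (distinct opp) γ≢α γ≢β

    -- Position of an arbitrary triple relative to A and B

    outside : ∀ {α β A B x} → Opposed α β A B → x ∉ verts A → x ∉ verts B →
              Unique (x ∷ verts A ++ verts B)
    outside {A = A} opp x∉A x∉B =
      ∉⇒Unique (λ m → [ x∉A , x∉B ] (∈-++⁻ (verts A) m)) (disjoint opp)

    outside-resp : ∀ {x A A′} → A ~ A′ → x ∉ verts A → x ∉ verts A′
    outside-resp (p , _) x∉A x∈A′ = x∉A (∈-resp-↭ (↭-sym p) x∈A′)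

    two-inside : ∀ {α β A B x y z} → Opposed α β A B → x ≢ y →
                 x ∈ verts A → y ∈ verts A → z ∉ verts A → Either (c x y z) α β
    two-inside {B = B} {z = z} opp x≢y x∈A y∈A z∉A with focus₂ x∈A y∈A x≢y | z ∈? verts B
    ... | _ , A~ | no z∉B = aao opp′ (outside opp′ (outside-resp A~ z∉A) z∉B)
      where opp′ = Opposed-resp-~ A~ ~-refl opp
    ... | _ , A~ | yes z∈B with focus z∈B
    ...   | _ , _ , B~ = mixed (Opposed-resp-~ A~ B~ opp)

    -- How many of `y` and `z` lie in `B` decides: none is `aoo`, one is `abo`, both is `mixed` with
    -- the sides exchanged.
    one-inside : ∀ {α β A B x y z} → Opposed α β A B → y ≢ z →
                 x ∈ verts A → y ∉ verts A → z ∉ verts A → Either (c x y z) α β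
    one-inside {A = A} {B} {x} {y} {z} opp y≢z x∈A y∉A z∉A
      with focus x∈A | y ∈? verts B | z ∈? verts B
    ... | _ , _ , A~ | no y∉B | no z∉B =
      aoo opp′ (∉⇒Unique (λ { (here y≡z) → y≢z y≡z ; (there m) → All.All¬⇒¬Any (head y-out) m })
                         (outside opp′ (outside-resp A~ z∉A) z∉B))
      where
      opp′ = Opposed-resp-~ A~ ~-refl opp
      y-out = outside opp′ (outside-resp A~ y∉A) y∉B
    ... | _ , _ , A~ | yes y∈B | yes z∈B with focus₂ y∈B z∈B y≢z
    ...   | _ , B~ = Either-cong rot (swap (mixed (Opposed-swap (Opposed-resp-~ A~ B~ opp))))
    one-inside opp y≢z x∈A y∉A z∉A | _ , _ , A~ | yes y∈B | no z∉B with focus y∈B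
    ... | _ , _ , B~ = abo opp′ (outside opp′ (outside-resp A~ z∉A) (outside-resp B~ z∉B))
      where opp′ = Opposed-resp-~ A~ B~ opp
    one-inside opp y≢z x∈A y∉A z∉A | _ , _ , A~ | no y∉B | yes z∈B with focus z∈B
    ... | _ , _ , B~ = Either-cong swap₂₃
                         (abo opp′ (outside opp′ (outside-resp A~ y∉A) (outside-resp B~ y∉B)))
      where opp′ = Opposed-resp-~ A~ B~ opp

    head-inside : ∀ {α β A B x y z} → Opposed α β A B → Distinct3 (x , y , z) →
                  x ∈ verts A → Either (c x y z) α β
    head-inside {A = A} {y = y} {z} opp (x≢y , y≢z , x≢z) x∈A with y ∈? verts A | z ∈? verts A
    ... | no y∉A  | no z∉A  = one-inside opp y≢z x∈A y∉A z∉A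
    ... | yes y∈A | no z∉A  = two-inside opp x≢y x∈A y∈A z∉A
    ... | no y∉A  | yes z∈A = Either-cong swap₂₃ (two-inside opp x≢z x∈A z∈A y∉A)
    ... | yes y∈A | yes z∈A with focus₂ x∈A y∈A x≢y
    ...   | _ , A~ with ∈-resp-↭ (proj₁ A~) z∈A
    ...     | here z≡x                 = contradiction (sym z≡x) x≢z
    ...     | there (here z≡y)         = contradiction (sym z≡y) y≢z
    ...     | there (there (here refl)) = inj₁ (≡.trans (sym (proj₂ A~)) (colourˡ opp))

    Distinct3-rot : ∀ {x y z : Fin n} → Distinct3 (x , y , z) → Distinct3 (y , z , x)
    Distinct3-rot (x≢y , y≢z , x≢z) = y≢z , ≢-sym x≢z , ≢-sym x≢y

    meeting : ∀ {α β A B x y z} → Opposed α β A B → Distinct3 (x , y , z) →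
              Any (_∈ verts A) (verts (x , y , z)) → Either (c x y z) α β
    meeting opp d (here x∈A)                 = head-inside opp d x∈A
    meeting opp d (there (here y∈A))         =
      Either-cong rot (head-inside opp (Distinct3-rot d) y∈A)
    meeting opp d (there (there (here z∈A))) =
      Either-cong rot⁻¹ (head-inside opp (Distinct3-rot (Distinct3-rot d)) z∈A)

    two-coloured : ∀ {α β A B x y z} → Opposed α β A B → Distinct3 (x , y , z) →
                   Either (c x y z) α β
    two-coloured {A = A} {B} {x} {y} {z} opp d@(x≢y , y≢z , x≢z)
      with Any.any? (_∈? verts A) (verts (x , y , z)) | Any.any? (_∈? verts B) (verts (x , y , z))
    ... | yes meetsA | _          = meeting opp d meetsA
    ... | no _       | yes meetsB = swap (meeting (Opposed-swap opp) d meetsB)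
    ... | no missA   | no missB   = ooo opp
      (Unique.++⁺ ((x≢y ∷ x≢z ∷ []) ∷ (y≢z ∷ []) ∷ [] ∷ []) (disjoint opp)
        λ { (v∈g , v∈AB) → [ missA ∘ lose v∈g , missB ∘ lose v∈g ] (∈-++⁻ (verts A) v∈AB) })

  -- Connectivity of the Kneser graph

  module Kneser (n≥7 : 7 ≤ n)
    (agree : ∀ {a b d e f g} → Unique (a ∷ b ∷ d ∷ e ∷ f ∷ g ∷ []) → c a b d ≡ c e f g) where

    -- The two triples cover four vertices; seven leave room for a triple disjoint from both, a
    -- common neighbour in the Kneser graph.
    exchange : ∀ {x y z z′} → Unique (x ∷ y ∷ z ∷ z′ ∷ []) → c x y z ≡ c x y z′
    exchange {x} {y} {z} {z′} u₄
      with fresh (x ∷ y ∷ z ∷ z′ ∷ []) (ℕ.≤-trans (ℕ.m≤n+m 5 2) n≥7)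
    ... | p , p∉ with fresh (p ∷ x ∷ y ∷ z ∷ z′ ∷ []) (ℕ.≤-trans (ℕ.m≤n+m 6 1) n≥7)
    ... | q , q∉ with fresh (q ∷ p ∷ x ∷ y ∷ z ∷ z′ ∷ []) n≥7
    ... | r , r∉ = ≡.trans (agree (pick u₇ (3F ∷ 4F ∷ 5F ∷ 0F ∷ 1F ∷ 2F ∷ [])))
                           (agree (pick u₇ (0F ∷ 1F ∷ 2F ∷ 3F ∷ 4F ∷ 6F ∷ [])))
      where u₇ = ∉⇒Unique r∉ (∉⇒Unique q∉ (∉⇒Unique p∉ u₄))

    shared-pair : ∀ {x y z z′} → Distinct3 (x , y , z) → Distinct3 (x , y , z′) →
                  c x y z ≡ c x y z′
    shared-pair {z = z} {z′} (x≢y , y≢z , x≢z) (_ , y≢z′ , x≢z′) with z ≟ z′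
    ... | yes refl = refl
    ... | no z≢z′  = exchange ((x≢y ∷ x≢z ∷ x≢z′ ∷ []) ∷ (y≢z ∷ y≢z′ ∷ []) ∷ (z≢z′ ∷ []) ∷ [] ∷ [])

    -- Change one vertex at a time: `xyz`, `xyp`, `xpq`.
    shared-vertex : ∀ {x y z p q} → Distinct3 (x , y , z) → Distinct3 (x , p , q) →
                    c x y z ≡ c x p q
    shared-vertex {y = y} {p = p} d@(x≢y , _) d′@(x≢p , _) with y ≟ p
    ... | yes refl = shared-pair d d′
    ... | no y≢p   = ≡.trans (shared-pair d (x≢y , y≢p , x≢p))
                     (≡.trans swap₂₃ (shared-pair (x≢p , ≢-sym y≢p , x≢y) d′))

    constant : ∀ {x y z p q r} → Distinct3 (x , y , z) → Distinct3 (p , q , r) →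
               c x y z ≡ c p q r
    constant {x} {p = p} d d′ with x ≟ p
    ... | yes refl = shared-vertex d d′
    ... | no x≢p with fresh (x ∷ p ∷ []) (ℕ.≤-trans (ℕ.m≤n+m 3 4) n≥7)
    -- The triple `{x, p, t}` shares a vertex with each of the two given ones.
    ...   | t , t∉ = ≡.trans (shared-vertex d (x≢p , p≢t , x≢t))
                     (≡.trans swap₁₂ (shared-vertex (≢-sym x≢p , x≢t , p≢t) d′))
      where
      x≢t = λ x≡t → t∉ (here (sym x≡t))
      p≢t = λ p≡t → t∉ (there (here (sym p≡t)))

-- From no rainbow messy path to at most two colours

Clash : ∀ {n} → Colouring n ℕ → Vec (Fin n) 6 → Set
Clash c (a ∷ b ∷ d ∷ e ∷ f ∷ g ∷ []) = Unique (a ∷ b ∷ d ∷ e ∷ f ∷ g ∷ []) × c a b d ≢ c e f g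

clash? : ∀ {n} (c : Colouring n ℕ) → Decidable (Clash c)
clash? c (a ∷ b ∷ d ∷ e ∷ f ∷ g ∷ []) =
  unique? _≟_ (a ∷ b ∷ d ∷ e ∷ f ∷ g ∷ []) ×-dec ¬? (c a b d ℕ.≟ c e f g)

AtMostTwoColours : ∀ {n} → Colouring n ℕ → Set
AtMostTwoColours c = ∃₂ λ α β → ∀ {x y z} → Distinct3 (x , y , z) → Either (c x y z) α β

monochromatic⇒atMostTwoColours : ∀ {n} (c : Colouring n ℕ) → 7 ≤ n →
  (∀ {x y z p q r} → Distinct3 (x , y , z) → Distinct3 (p , q , r) → c x y z ≡ c p q r) →
  AtMostTwoColours c
-- Three `s≤s` expose enough of `n` to type the literals; the two colours are chosen equal.
monochromatic⇒atMostTwoColours c (s≤s (s≤s (s≤s _))) constant =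
  c 0F 1F 2F , c 0F 1F 2F , λ d → inj₁ (constant d ((λ ()) , (λ ()) , (λ ())))

atMostTwoColours : ∀ {n} (c : Colouring n ℕ) → Symmetric c → 7 ≤ n → NoRainbowMessy c →
                   AtMostTwoColours c
atMostTwoColours c sym-c n≥7 messy-free
  with anyVec? 6 (clash? c)
... | yes ((a ∷ b ∷ d ∷ e ∷ f ∷ g ∷ []) , u , A≢B) =
  c a b d , c e f g , two-coloured (opposed {A = a , b , d} {e , f , g} u refl refl A≢B)
  where
  open SymmetricColouring c sym-c
  open TwoColours messy-free
... | no none = monochromatic⇒atMostTwoColours c n≥7 constant
  where
  open SymmetricColouring c sym-c
  open Kneser n≥7 (λ {a} {b} {d} {e} {f} {g} u →
    decidable-stable (c a b d ℕ.≟ c e f g) λ A≢B → none (a ∷ b ∷ d ∷ e ∷ f ∷ g ∷ [] , u , A≢B))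

OddMiddle : ∀ {n} → Colouring n ℕ → Vec (Fin n) 6 → Set
OddMiddle c (a ∷ b ∷ d ∷ e ∷ f ∷ g ∷ []) = c b d e ≢ c a b d × c b d e ≢ c e f g

oddMiddle? : ∀ {n} (c : Colouring n ℕ) → Decidable (OddMiddle c)
oddMiddle? c (a ∷ b ∷ d ∷ e ∷ f ∷ g ∷ []) =
  ¬? (c b d e ℕ.≟ c a b d) ×-dec ¬? (c b d e ℕ.≟ c e f g)

-- A failed search becomes the positive form of rainbow-freeness through `Either-stable`.
rainbow-or-free : ∀ {n} (c : Colouring n ℕ) → RainbowCopy messy c ⊎ NoRainbowMessy c
rainbow-or-free c
  with anyVec? 6 (λ v → clash? c v ×-dec oddMiddle? c v)
... | yes ((a ∷ b ∷ d ∷ e ∷ f ∷ g ∷ []) , (u , A≢B) , M≢A , M≢B) =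
  inj₁ (lookup (a ∷ b ∷ d ∷ e ∷ f ∷ g ∷ []) , lookup-injective u , λ
    { 0F 0F i≢i → contradiction refl i≢i
    ; 0F 1F _   → ≢-sym M≢A
    ; 0F 2F _   → A≢B
    ; 1F 0F _   → M≢A
    ; 1F 1F i≢i → contradiction refl i≢i
    ; 1F 2F _   → M≢B
    ; 2F 0F _   → ≢-sym A≢B
    ; 2F 1F _   → ≢-sym M≢B
    ; 2F 2F i≢i → contradiction refl i≢i })
... | no none = inj₂ λ {a} {b} {d} {e} {f} {g} u A≢B →
  Either-stable λ M≢A M≢B →
    contradiction (a ∷ b ∷ d ∷ e ∷ f ∷ g ∷ [] , (u , A≢B) , M≢A , M≢B) none

-- Passing between two colours and arbitrarily many

is? : ℕ → ℕ → Fin 2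
is? α γ = if ⌊ γ ℕ.≟ α ⌋ then 0F else 1F

is?-0F : ∀ {α γ} → is? α γ ≡ 0F → γ ≡ α
is?-0F {α} {γ} eq with γ ℕ.≟ α
... | yes γ≡α = γ≡α

is?-1F : ∀ {α β γ} → Either γ α β → is? α γ ≡ 1F → γ ≡ β
is?-1F {α} {β} {γ} γ∈αβ eq with γ ℕ.≟ α
... | no γ≢α = Either-left (swap γ∈αβ) γ≢α

mono-if-two-coloured : ∀ {n} H (c : Colouring n ℕ) → Symmetric c → Ramsey2Prop H n →
                       AtMostTwoColours c → MonoCopy H c
mono-if-two-coloured H c sym-c ramsey (α , β , two)
  with ramsey (λ a b d → is? α (c a b d))
              (λ a b d → cong (is? α) (proj₁ (sym-c a b d)) , cong (is? α) (proj₂ (sym-c a b d)))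
... | φ , inj , 0F , mono = φ , inj , α , All.map is?-0F mono
-- Class `1F` only says that the colour is not `α`. This means `β` on genuine 3-sets, hence the
-- appeal to `edges-3sets` and to the injectivity of `φ`.
... | φ , inj , 1F , mono = φ , inj , β , All.zipWith
  (λ { ((a≢b , b≢d , a≢d) , eq) → is?-1F (two (a≢b ∘ inj , b≢d ∘ inj , a≢d ∘ inj)) eq })
  (edges-3sets H , mono)

ramsey⇒constrained : ∀ H {n} → 7 ≤ n → Ramsey2Prop H n → ConstrainedProp H messy n
ramsey⇒constrained H n≥7 ramsey c sym-c with rainbow-or-free c
... | inj₁ rainbow    = inj₂ rainbow
... | inj₂ messy-free =
  inj₁ (mono-if-two-coloured H c sym-c ramsey (atMostTwoColours c sym-c n≥7 messy-free))

constant-toℕ : ∀ {A : Set} (f : A → Fin 2) {col xs} → All (λ x → toℕ (f x) ≡ col) xs →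
               ∃ λ col′ → All (λ x → f x ≡ col′) xs
-- Without edges `col` may be any natural number, so a default colour is supplied.
constant-toℕ f []         = 0F , []
constant-toℕ f (refl ∷ p) = _ , refl ∷ All.map toℕ-injective p

-- Applied to each `m` below `r`, this carries the minimality of `r` over to the constrained
-- property.
constrained⇒ramsey : ∀ H {n} → ConstrainedProp H messy n → Ramsey2Prop H n
constrained⇒ramsey H constrained c sym-c
  with constrained (λ a b d → toℕ (c a b d))
                   (λ a b d → cong toℕ (proj₁ (sym-c a b d)) , cong toℕ (proj₂ (sym-c a b d)))
... | inj₁ (φ , inj , _ , mono) = φ , inj , constant-toℕ (colourOf c ∘ mapT φ) mono
-- Three edges in two colours: two of them agree.
... | inj₂ (φ , _ , rainbow) with pigeonhole (ℕ.n<1+n 2) (colourOf c ∘ mapT φ ∘ lookup messyEdges)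
...   | i , j , i<j , eq = contradiction (cong toℕ eq) (rainbow i j (<⇒≢ i<j))

theorem1p9 : (H : ThreeGraph) (r : ℕ) → IsR2 H r → 7 ≤ r → IsF H messy r
theorem1p9 H r (ramsey , least) r≥7 =
  ramsey⇒constrained H r≥7 ramsey , λ m m<r → least m m<r ∘ constrained⇒ramsey H
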